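{- For each integer $n\geq 1$, the $D_{\omega^n}(\boldsymbol{\Sigma}^1_1)$-complete tree language $\mathcal{L}_n$ is Wadge reducible to the game tree language $W_{(0,2)}$, i.e. $\mathcal{L}_n\leq_W W_{(0,2)}$. In particular, the language $W_{(0,2)}$ is not in any class $D_\alpha(\boldsymbol{\Sigma}^1_1)$ for $\alpha<\omega^\omega$.
   Context: **Trees.** For a finite alphabet $\Sigma$, $T_\Sigma^\omega$ is the set of all functions $t:\{l,r\}^\star\to\Sigma$ (infinite binary trees labelled in $\Sigma$; the root is the empty word $\lambda$). For $u\in\{l,r\}^\star$, $t_u\in T_\Sigma^\omega$ is the subtree $t_u(v)=t(u\cdot v)$. A path of $t$ is an infinite sequence $t(u_0)t(u_1)\cdots$ of labels along an infinite branch, where $u_0=\lambda$ and $u_{i+1}\in\{u_il,u_ir\}$ for all $i$. **Topology.** $\Sigma^\omega$ (infinite words) and $T_\Sigma^\omega$ carry the Cantor (product of discrete) topology. $\boldsymbol{\Sigma}^1_1$ is the class of analytic sets. **Difference hierarchy.** A countable ordinal is even if it is of the form $\gamma+m$ with $\gamma$ equal to $0$ or a limit ordinal and $m$ an even non-negative integer; otherwise it is odd. For an ordinal $\eta<\omega_1$ and an increasing sequence $(A_\theta)_{\theta<\eta}$ of subsets of a space $X$, $D_\eta[(A_\theta)_{\theta<\eta}]$ is the set of $x\in X$ such that $x\in A_\theta\setminus\bigcup_{\theta'<\theta}A_{\theta'}$ for some $\theta<\eta$ whose parity is opposite to that of $\eta$. For $X=\Sigma^\omega$ or $X=T_\Sigma^\omega$,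 $D_\eta(\boldsymbol{\Sigma}^1_1)$ is the class of all sets $D_\eta[(A_\theta)_{\theta<\eta}]$ with every $A_\theta\subseteq X$ in $\boldsymbol{\Sigma}^1_1$. **Reducibility and completeness.** $E\leq_W F$ (Wadge reducibility) means $E=f^{ -1}(F)$ for some continuous function $f$ between the ambient spaces. A set $F$ (in a space $\Sigma^\omega$ or $T_\Sigma^\omega$) is $D_\eta(\boldsymbol{\Sigma}^1_1)$-complete if for every finite alphabet $Y$ and every $E\subseteq Y^\omega$: $E\in D_\eta(\boldsymbol{\Sigma}^1_1)$ iff $E\leq_W F$. **The languages $\mathcal{L}$ and $\mathcal{L}_n$.** $\mathcal{L}\subseteq T^\omega_{\{0,1\}}$ is the set of trees having at least one path containing infinitely many letters $1$. For non-negative integers write $\mathrm{Ord}(a_{n-1},\ldots,a_0)=\omega^{n-1}\cdot a_{n-1}+\cdots+\omega\cdot a_1+a_0$. For $n=1$, $$\mathcal{L}_1=\{t\in T^\omega_{\{0,1\}}\mid \exists m\geq 0\ \ t_{l^m\cdot r}\in\mathcal{L}\text{ and }\min\{m\geq 0\mid t_{l^m\cdot r}\in\mathcal{L}\}\text{ is odd}\}.$$ For $n\geq 2$, $\mathcal{L}_n$ is the set of $t\in T^\omega_{\{0,1\}}$ for which there exist integers $a_{n-1},\ldots,a_0\geq 0$ such that: (1) $t_{l^{a_{n-1}}\cdot r\cdot l^{a_{n-2}}\cdot r\cdots l^{a_0}\cdot r}\in\mathcal{L}$ and $\mathrm{Ord}(a_{n-1},\ldots,a_0)$ is odd; (2)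 for all integers $b_{n-1},\ldots,b_0\ge 0$ with $\mathrm{Ord}(b_{n-1},\ldots,b_0)<\mathrm{Ord}(a_{n-1},\ldots,a_0)$, the tree $t_{l^{b_{n-1}}\cdot r\cdot l^{b_{n-2}}\cdot r\cdots l^{b_0}\cdot r}$ is not in $\mathcal{L}$. **Game tree language $W_{(0,2)}$.** Let $\Sigma_{(0,2)}=\{\exists,\forall\}\times\{0,1,2\}$; for a letter $a$ write $a=(a_1,a_2)$. For $t\in T^\omega_{\Sigma_{(0,2)}}$, the parity game $G(t)$ is played by Eve and Adam with positions $v\in\{l,r\}^\star$, starting at $\lambda$. At position $v$, Eve moves if $t(v)_1=\exists$ and Adam moves if $t(v)_1=\forall$; a move goes from $v$ to $vl$ or $vr$. Eve wins an infinite play $v_0,v_1,\ldots$ iff $\limsup_{k\to\infty}t(v_k)_2$ is even; otherwise Adam wins. $W_{(0,2)}\subseteq T^\omega_{\Sigma_{(0,2)}}$ is the set of trees $t$ such that Eve has a winning strategy in $G(t)$. -}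

module Defs where

open import Level using (0ℓ) renaming (suc to lsuc)
open import Data.Fin.Base using (Fin; toℕ; zero; suc)
open import Data.List.Base using (List; []; _∷_; _++_; _∷ʳ_; replicate)
open import Data.List.Relation.Unary.All using (All)
open import Data.Nat.Base using (ℕ; zero; suc; _≤_; _<_; _≥_)
open import Data.Nat.Divisibility using (_∣_)
open import Data.Product.Base using (Σ-syntax; ∃; ∃-syntax; _×_; proj₁; proj₂)
open import Data.Sum.Base using (_⊎_)
open import Data.Vec.Base as Vec using (Vec; []; _∷_)
open import Data.Vec.Relation.Binary.Lex.Strict using (Lex-<)
open import Function.Bundles using (_⇔_; _↔_)
open import Relation.Binary.Core using (Rel)
open import Relation.Binary.PropositionalEquality.Core using (_≡_)
open import Relation.Nullary.Negation.Core using (¬_)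
open import Relation.Unary using (Pred; _∈_; _∉_; _⊆_; _≐_)

------------------------------------------------------------------------
-- Words and trees

data Dir : Set where
  l r : Dir

Word : Set → Set
Word Y = ℕ → Y

-- A node is listed from the root downwards, so the concatenation u·v is
-- u ++ v and the children of u are u ∷ʳ l and u ∷ʳ r.
Node : Set
Node = List Dir

Tree : Set → Set
Tree Y = Node → Y

subtree : {Y : Set} → Tree Y → Node → Tree Y
subtree t u v = t (u ++ v)

-- The labels read along a branch u are those of the path λ i → t (u i).
IsBranch : (ℕ → Node) → Set
IsBranch u = u 0 ≡ [] × (∀ i → ∃[ d ] u (suc i) ≡ u i ∷ʳ d)

------------------------------------------------------------------------
-- Topology.  Every space is of the form I → B (I = ℕ for words, I = Node
-- for trees), with the product of the discrete topologies: the points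
-- agreeing with x on a finite list F of coordinates form a basic
-- neighbourhood of x.

infix 4 _≈[_]_

_≈[_]_ : {I B : Set} → (I → B) → List I → (I → B) → Set
x ≈[ F ] y = All (λ i → x i ≡ y i) F

Continuous : {I B J C : Set} → ((I → B) → (J → C)) → Set
Continuous f = ∀ x G → ∃[ F ] (∀ y → x ≈[ F ] y → f x ≈[ G ] f y)

Baire : Set
Baire = ℕ → ℕ

-- Closed subset of X × ω^ω, i.e. one whose complement is open.
IsClosed : {I B : Set} → ((I → B) → Baire → Set) → Set
IsClosed R = ∀ x y → ¬ R x y →
  ∃[ F ] ∃[ G ] (∀ x′ y′ → x ≈[ F ] x′ → y ≈[ G ] y′ → ¬ R x′ y′)

-- 𝚺¹₁: the projections of the closed subsets of X × ω^ω.
Analytic : {I B : Set} → Pred (Pred (I → B) 0ℓ) (lsuc 0ℓ)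
Analytic {I} {B} A =
  Σ[ R ∈ ((I → B) → Baire → Set) ] IsClosed R × (∀ x → x ∈ A ⇔ ∃ (R x))

infix 4 _≤W_

_≤W_ : {I B J C : Set} → Pred (I → B) 0ℓ → Pred (J → C) 0ℓ → Set
_≤W_ {I} {B} {J} {C} E F =
  Σ[ f ∈ ((I → B) → (J → C)) ] Continuous f × (∀ x → x ∈ E ⇔ f x ∈ F)

------------------------------------------------------------------------
-- Difference hierarchy.  Ω is meant to be a well-order, an element of
-- which stands for the order type of the elements below it.

module DifferenceHierarchy {Ω : Set} (_≺_ : Rel Ω 0ℓ) where

  -- θ is the immediate successor of β.
  _⋖_ : Rel Ω 0ℓ
  β ⋖ θ = β ≺ θ × ¬ (∃[ δ ] (β ≺ δ × δ ≺ θ))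

  ZeroOrLimit : Pred Ω 0ℓ
  ZeroOrLimit γ = ¬ (∃[ β ] β ⋖ γ)

  -- γ + m ≐ₒ θ says that θ is the ordinal γ + m.
  infix 4 _+_≐ₒ_
  data _+_≐ₒ_ (γ : Ω) : ℕ → Ω → Set where
    +-zero : γ + 0 ≐ₒ γ
    +-suc  : ∀ {m β θ} → γ + m ≐ₒ β → β ⋖ θ → γ + suc m ≐ₒ θ

  Even : Pred Ω 0ℓ
  Even θ = ∃[ γ ] ∃[ m ] (ZeroOrLimit γ × γ + m ≐ₒ θ × 2 ∣ m)

  Odd : Pred Ω 0ℓ
  Odd θ = ¬ Even θ

  OppositeParity : Rel Ω 0ℓ
  OppositeParity θ η = (Odd θ × Even η) ⊎ (Even θ × Odd η)

  -- Only the values of A at ordinals θ ≺ η are used; the others are junk.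
  Diff : {X : Set} → Ω → (Ω → Pred X 0ℓ) → Pred X 0ℓ
  Diff η A x = ∃[ θ ] (θ ≺ η × OppositeParity θ η ×
                       x ∈ A θ × (∀ θ′ → θ′ ≺ θ → x ∉ A θ′))

  D : {I B : Set} → Ω → Pred (Pred (I → B) 0ℓ) (lsuc 0ℓ)
  D {I} {B} η E = Σ[ A ∈ (Ω → Pred (I → B) 0ℓ) ]
    (∀ θ → θ ≺ η → Analytic (A θ)) ×
    (∀ θ θ′ → θ ≺ θ′ → θ′ ≺ η → A θ ⊆ A θ′) ×
    E ≐ Diff η A

  Complete : {I B : Set} → Ω → Pred (I → B) 0ℓ → Set₁
  Complete η F = ∀ (k : ℕ) (Y : Set) → Y ↔ Fin k →
    (E : Pred (Word Y) 0ℓ) → E ∈ D η ⇔ E ≤W F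

------------------------------------------------------------------------
-- Ordinals below ω^ω.  The vector a_{k-1} ∷ … ∷ a_0 ∷ [] stands for
-- ω^{k-1}·a_{k-1} + … + ω·a_1 + a_0.  With the lexicographic order,
-- Ordinal k is the ordinal ω^k, and the ordinals below ω^ω are those
-- denoted by an element of Ordinal k for some k.

Ordinal : ℕ → Set
Ordinal k = Vec ℕ k

infix 4 _<ₒ_

_<ₒ_ : ∀ {k} → Rel (Ordinal k) 0ℓ
_<ₒ_ = Lex-< _≡_ _<_

ω^_ : (n : ℕ) → Ordinal (suc n)
ω^ n = 1 ∷ Vec.replicate n 0

open module DifferenceHierarchyₒ {k : ℕ} =
  DifferenceHierarchy (_<ₒ_ {k}) public

------------------------------------------------------------------------
-- The languages ℒ and ℒₙ

ℒ : Pred (Tree (Fin 2)) 0ℓ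
ℒ t = ∃[ u ] (IsBranch u × (∀ N → ∃[ m ] (m ≥ N × t (u m) ≡ suc zero)))

-- l^{a_{n-1}} · r · l^{a_{n-2}} · r ⋯ l^{a_0} · r
node : ∀ {n} → Vec ℕ n → Node
node []       = []
node (a ∷ as) = replicate a l ++ r ∷ node as

-- For n = 1 this says that min {m ∣ t_{l^m·r} ∈ ℒ} exists and is odd.
ℒₙ : ℕ → Pred (Tree (Fin 2)) 0ℓ
ℒₙ n t = Σ[ a ∈ Ordinal n ]
  (subtree t (node a) ∈ ℒ × Odd a) ×
  (∀ (b : Ordinal n) → b <ₒ a → subtree t (node b) ∉ ℒ)

------------------------------------------------------------------------
-- The game tree language W₍₀,₂₎

data Player : Set where
  Eve Adam : Player

-- Eve and Adam stand for the letters ∃ and ∀.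
Σ₍₀,₂₎ : Set
Σ₍₀,₂₎ = Player × Fin 3

IsLimsup : (ℕ → ℕ) → ℕ → Set
IsLimsup p m = (∃[ N ] (∀ k → k ≥ N → p k ≤ m)) ×
               (∀ N → ∃[ k ] (k ≥ N × p k ≡ m))

EveWinsPlay : Tree Σ₍₀,₂₎ → (ℕ → Node) → Set
EveWinsPlay t v = ∃[ m ] (IsLimsup (λ k → toℕ (proj₂ (t (v k)))) m × 2 ∣ m)

-- A position determines the history of the play, so a strategy for Eve is
-- a function of the position; its values at Adam's positions are junk.
Strategy : Set
Strategy = Node → Dir

Follows : Tree Σ₍₀,₂₎ → Strategy → (ℕ → Node) → Set
Follows t σ v = ∀ k → proj₁ (t (v k)) ≡ Eve → v (suc k) ≡ v k ∷ʳ σ (v k)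

W₍₀,₂₎ : Pred (Tree Σ₍₀,₂₎) 0ℓ
W₍₀,₂₎ t = Σ[ σ ∈ Strategy ]
  (∀ v → IsBranch v → Follows t σ v → EveWinsPlay t v)

{-# OPTIONS --safe #-}
module Submission where

-- ℒ is 𝚺¹₁-complete: the tree of a closed set R turns a witness y of x ∈ A into
-- a branch with infinitely many 1s.  Grafting such trees at the nodes coding
-- the ordinals below ω^n gives the completeness of ℒₙ.  In the game for
-- ℒₙ ≤W W₍₀,₂₎ Eve names the first ordinal a with t_a ∈ ℒ; Adam either makes
-- her prove t_a ∈ ℒ (a Büchi condition, priorities 1 and 2) or proves t_b ∈ ℒ
-- for some b < a himself (priorities 0 and 1).
--
-- The reductions of analytic sets read, for the label at u, only coordinates
-- of rank below |u|, so their composition with the game is a contraction.  If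
-- W₍₀,₂₎ were in D α, its complement would again be decided by the parity of a
-- first ordinal, hence reduce to W₍₀,₂₎ by a contraction; the fixed point of
-- that contraction would be both in W₍₀,₂₎ and outside it.

open import Defs
open import Axiom.ExcludedMiddle using (ExcludedMiddle)
open import Data.Empty using (⊥-elim)
open import Data.Fin.Base using (Fin; zero; suc; toℕ)
open import Data.Fin.Properties using (toℕ≤pred[n])
open import Data.List.Base using (List; []; _∷_; _++_; _∷ʳ_; [_]; length; replicate; applyUpTo; upTo; map)
open import Data.List.Membership.Propositional using () renaming (_∈_ to _∈ₗ_)
open import Data.List.Membership.Propositional.Properties using (∈-upTo⁺; ∈-map⁺; ∈-++⁺ˡ; ∈-++⁺ʳ)
open import Data.List.Properties using (length-applyUpTo; applyUpTo-∷ʳ; length-++;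
  ++-assoc; ++-identityʳ; ∷ʳ-injective; ∷ʳ-injectiveʳ; ∷-injective)
open import Data.List.Relation.Unary.All as All using (All; []; _∷_)
open import Data.List.Relation.Unary.Any using (here; there)
open import Data.Maybe.Base as Maybe using (Maybe; just; nothing; maybe′)
open import Data.Nat.Base
open import Data.Nat.Divisibility using (_∣_; divides; ∣1⇒≡1)
open import Data.Nat.Induction using (<-wellFounded)
open import Data.Nat.Properties renaming (+-suc to m+1+n≡1+m+n)
open import Data.Product.Base using (Σ-syntax; ∃; ∃-syntax; _×_; _,_; proj₁; proj₂; map₁; map₂)
open import Data.Sum.Base using (_⊎_; inj₁; inj₂)
open import Data.Unit.Base using (⊤; tt)
open import Data.Vec.Base as Vec using (Vec; []; _∷_; toList)
import Data.Vec.Relation.Binary.Lex.Strict as Lex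
import Data.Vec.Relation.Binary.Pointwise.Inductive as Pointwise
open import Function.Base using (_∘_; id)
open import Function.Bundles using (_⇔_; mk⇔; Equivalence)
open import Induction.WellFounded using (Acc; acc)
open import Level using (0ℓ)
open import Relation.Binary.Definitions using (tri<; tri≈; tri>)
open import Relation.Binary.PropositionalEquality hiding ([_])
open import Relation.Binary.Structures using (IsStrictTotalOrder)
open import Relation.Nullary using (¬_; Dec; yes; no)
open import Relation.Unary using (Pred; _∈_; _∉_; _≐_)

open Equivalence using (to; from)

infix 8 _↾_
_↾_ : {A : Set} → (ℕ → A) → ℕ → List A
f ↾ k = applyUpTo f k

↾-+ : {A : Set} (f : ℕ → A) (m k : ℕ) → f ↾ (m + k) ≡ f ↾ m ++ (f ∘ (m +_)) ↾ k
↾-+ f zero    k = refl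
↾-+ f (suc m) k = cong (f 0 ∷_) (↾-+ (f ∘ suc) m k)

↾-cong : {A : Set} {f g : ℕ → A} (k : ℕ) → (∀ i → i < k → f i ≡ g i) → f ↾ k ≡ g ↾ k
↾-cong zero    f≡g = refl
↾-cong (suc k) f≡g = cong₂ _∷_ (f≡g 0 z<s) (↾-cong k λ i i<k → f≡g (suc i) (s<s i<k))

↾-injective : {A : Set} {f g : ℕ → A} (k : ℕ) → f ↾ k ≡ g ↾ k → ∀ i → i < k → f i ≡ g i
↾-injective (suc k) eq zero    _   = proj₁ (∷-injective eq)
↾-injective (suc k) eq (suc i) i<k = ↾-injective k (proj₂ (∷-injective eq)) i (s<s⁻¹ i<k)

infixr 6 _⊹_
_⊹_ : {A : Set} → List A → (ℕ → A) → (ℕ → A)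
([]      ⊹ f) k       = f k
((a ∷ u) ⊹ f) zero    = a
((a ∷ u) ⊹ f) (suc k) = (u ⊹ f) k

⊹-↾ : {A : Set} (u : List A) (f : ℕ → A) (k : ℕ) → (u ⊹ f) ↾ (length u + k) ≡ u ++ f ↾ k
⊹-↾ []      f k = refl
⊹-↾ (a ∷ u) f k = cong (a ∷_) (⊹-↾ u f k)

⊹-+ : {A : Set} (u : List A) (f : ℕ → A) (k : ℕ) → (u ⊹ f) (length u + k) ≡ f k
⊹-+ []      f k = refl
⊹-+ (a ∷ u) f k = ⊹-+ u f k

⊹-< : {A : Set} (u : List A) (f g : ℕ → A) → g ↾ length u ≡ u → ∀ k → k < length u → (u ⊹ f) k ≡ g k
⊹-< (a ∷ u) f g eq zero    _   = sym (proj₁ (∷-injective eq))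
⊹-< (a ∷ u) f g eq (suc k) k<n = ⊹-< u f (g ∘ suc) (proj₂ (∷-injective eq)) k (s<s⁻¹ k<n)

Infinitely : Pred ℕ 0ℓ → Set
Infinitely P = ∀ N → ∃[ m ] (m ≥ N × P m)

path-isBranch : (δ : ℕ → Dir) → IsBranch (δ ↾_)
path-isBranch δ = refl , λ i → δ i , sym (applyUpTo-∷ʳ δ i)

branch-path : {u : ℕ → Node} → IsBranch u → ∃[ δ ] (∀ k → u k ≡ δ ↾ k)
branch-path {u} (u₀ , step) = δ , prefix
  where
  δ : ℕ → Dir
  δ i = proj₁ (step i)
  prefix : ∀ k → u k ≡ δ ↾ k
  prefix zero    = u₀
  prefix (suc k) = trans (proj₂ (step k)) (trans (cong (_∷ʳ δ k) (prefix k)) (applyUpTo-∷ʳ δ k))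

ℒ⇔path : (t : Tree (Fin 2)) → t ∈ ℒ ⇔ (∃[ δ ] Infinitely (λ m → t (δ ↾ m) ≡ suc zero))
ℒ⇔path t = mk⇔
  (λ (u , br , inf) → let δ , u≡δ = branch-path br in
    δ , λ N → let m , m≥N , eq = inf N in m , m≥N , trans (cong t (sym (u≡δ m))) eq)
  (λ (δ , inf) → δ ↾_ , path-isBranch δ , inf)

ℒ-resp : {s t : Tree (Fin 2)} → (∀ u → s u ≡ t u) → s ∈ ℒ → t ∈ ℒ
ℒ-resp s≡t (u , br , inf) = u , br , λ N → let m , m≥N , eq = inf N in m , m≥N , trans (sym (s≡t (u m))) eq

-- Topology in terms of ranks

record Ranked (I : Set) : Set where
  field
    rank    : I → ℕ
    below   : ℕ → List I
    ∈-below : ∀ {i k} → rank i < k → i ∈ₗ below k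

  Agree : {B : Set} → ℕ → (I → B) → (I → B) → Set
  Agree k x y = ∀ i → rank i < k → x i ≡ y i

ℕ-ranked : Ranked ℕ
ℕ-ranked = record { rank = id ; below = upTo ; ∈-below = ∈-upTo⁺ }

node-ranked : Ranked Node
node-ranked = record { rank = length ; below = shorter ; ∈-below = ∈-shorter _ _ }
  where
  shorter : ℕ → List Node
  shorter zero    = []
  shorter (suc k) = [] ∷ map (l ∷_) (shorter k) ++ map (r ∷_) (shorter k)
  ∈-shorter : ∀ u k → length u < k → u ∈ₗ shorter k
  ∈-shorter []      (suc k) _   = here refl
  ∈-shorter (l ∷ u) (suc k) u<k =
    there (∈-++⁺ˡ (∈-map⁺ (l ∷_) (∈-shorter u k (s<s⁻¹ u<k))))
  ∈-shorter (r ∷ u) (suc k) u<k =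
    there (∈-++⁺ʳ (map (l ∷_) (shorter k)) (∈-map⁺ (r ∷_) (∈-shorter u k (s<s⁻¹ u<k))))

sup : {J : Set} → (J → ℕ) → List J → ℕ
sup c []      = 0
sup c (j ∷ G) = c j ⊔ sup c G

≤-sup : {J : Set} (c : J → ℕ) (G : List J) → All (λ j → c j ≤ sup c G) G
≤-sup c []      = []
≤-sup c (j ∷ G) = m≤m⊔n (c j) _ ∷ All.map (λ le → ≤-trans le (m≤n⊔m (c j) _)) (≤-sup c G)

module _ {I : Set} (I-ranked : Ranked I) where
  open Ranked I-ranked

  modulus⇒continuous : {B J C : Set} (f : (I → B) → (J → C)) (c : J → ℕ) →
    (∀ x y j → Agree (c j) x y → f x j ≡ f y j) → Continuous f
  modulus⇒continuous f c mod x G = below (sup c G) , λ y x≈y →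
    All.map (λ {j} le → mod x y j λ i i<c → All.lookup x≈y (∈-below (<-≤-trans i<c le))) (≤-sup c G)

  Causal : {B C : Set} → ((I → B) → Tree C) → Set
  Causal f = ∀ x y u → Agree (length u) x y → f x u ≡ f y u

  closed-limit : ExcludedMiddle 0ℓ → {B : Set} {R : (I → B) → Baire → Set} → IsClosed R →
    ∀ x y → (∀ k → ∃[ x′ ] ∃[ y′ ] (R x′ y′ × Agree k x x′ × y ↾ k ≡ y′ ↾ k)) → R x y
  closed-limit em {R = R} closed x y approx with em {R x y}
  ... | yes Rxy = Rxy
  ... | no ¬Rxy =
    let F , G , far = closed x y ¬Rxy
        K = sup (suc ∘ rank) F ⊔ sup suc G
        x′ , y′ , Rx′y′ , x≈ , y≈ = approx K
    in ⊥-elim (far x′ y′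
         (All.map (λ le → x≈ _ (≤-trans le (m≤m⊔n _ _))) (≤-sup (suc ∘ rank) F))
         (All.map (λ le → ↾-injective K y≈ _ (≤-trans le (m≤n⊔m (sup (suc ∘ rank) F) _))) (≤-sup suc G))
         Rx′y′)

-- Every analytic set reduces to ℒ

blocksFrom : ℕ → Node → List ℕ
blocksFrom c []      = []
blocksFrom c (l ∷ u) = blocksFrom (suc c) u
blocksFrom c (r ∷ u) = c ∷ blocksFrom 0 u

blocks : Node → List ℕ
blocks = blocksFrom 0

length-blocksFrom : ∀ c u → length (blocksFrom c u) ≤ length u
length-blocksFrom c []      = z≤n
length-blocksFrom c (l ∷ u) = m≤n⇒m≤1+n (length-blocksFrom (suc c) u)
length-blocksFrom c (r ∷ u) = s≤s (length-blocksFrom 0 u)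

blocksFrom-++ : ∀ c u v → ∃[ c′ ] blocksFrom c (u ++ v) ≡ blocksFrom c u ++ blocksFrom c′ v
blocksFrom-++ c []      v = c , refl
blocksFrom-++ c (l ∷ u) v = blocksFrom-++ (suc c) u v
blocksFrom-++ c (r ∷ u) v = let c′ , eq = blocksFrom-++ 0 u v in c′ , cong (c ∷_) eq

blocks-∷ʳr : ∀ u → length (blocks (u ∷ʳ r)) ≡ suc (length (blocks u))
blocks-∷ʳr u = let c , eq = blocksFrom-++ 0 u [ r ] in
  trans (cong length eq) (trans (length-++ (blocks u)) (+-comm _ 1))

blocks-mono : (δ : ℕ → Dir) {m m′ : ℕ} → m ≤ m′ → ∃[ s ] blocks (δ ↾ m′) ≡ blocks (δ ↾ m) ++ s
blocks-mono δ {m} m≤m′ with k , refl ← m≤n⇒∃[o]m+o≡n m≤m′ =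
  let c , eq = blocksFrom-++ 0 (δ ↾ m) ((δ ∘ (m +_)) ↾ k) in
  _ , trans (cong blocks (↾-+ δ m k)) eq

spellFrom : ℕ → Baire → ℕ → Dir
spellFrom zero    y zero    = r
spellFrom (suc c) y zero    = l
spellFrom zero    y (suc m) = spellFrom (y 0) (y ∘ suc) m
spellFrom (suc c) y (suc m) = spellFrom c y m

-- The branch l^{y 0} · r · l^{y 1} · r ⋯
spell : Baire → ℕ → Dir
spell y = spellFrom (y 0) (y ∘ suc)

blocks-spellFrom : ∀ c₀ c y k →
  blocksFrom c₀ (spellFrom c y ↾ (suc c + k)) ≡ (c + c₀) ∷ blocks (spell y ↾ k)
blocks-spellFrom c₀ zero    y k = refl
blocks-spellFrom c₀ (suc c) y k =
  trans (blocks-spellFrom (suc c₀) c y k) (cong (_∷ blocks (spell y ↾ k)) (m+1+n≡1+m+n c c₀))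

spellFrom-step : ∀ c y k → spellFrom c y (suc c + k) ≡ spell y k
spellFrom-step zero    y k = refl
spellFrom-step (suc c) y k = spellFrom-step c y k

spellFrom-r : ∀ c y → spellFrom c y c ≡ r
spellFrom-r zero    y = refl
spellFrom-r (suc c) y = spellFrom-r c y

blocks-spell : ∀ N y → ∃[ m ] (m ≥ N × spell y m ≡ r × blocks (spell y ↾ suc m) ≡ y ↾ suc N)
blocks-spell zero y = y 0 , z≤n , spellFrom-r (y 0) (y ∘ suc) ,
  subst (λ k → blocks (spell y ↾ suc k) ≡ [ y 0 ]) (+-identityʳ (y 0))
    (trans (blocks-spellFrom 0 (y 0) (y ∘ suc) 0) (cong [_] (+-identityʳ (y 0))))
blocks-spell (suc N) y with m , m≥N , r! , eq ← blocks-spell N (y ∘ suc) =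
  suc (y 0) + m , s≤s (≤-trans m≥N (m≤n+m m (y 0))) ,
  trans (spellFrom-step (y 0) (y ∘ suc) m) r! ,
  subst (λ k → blocks (spell y ↾ k) ≡ y ↾ suc (suc N)) (cong suc (m+1+n≡1+m+n (y 0) m))
    (trans (blocks-spellFrom 0 (y 0) (y ∘ suc) (suc m)) (cong₂ _∷_ (+-identityʳ (y 0)) eq))

nth : List ℕ → ℕ → ℕ
nth []      j       = 0
nth (a ∷ s) zero    = a
nth (a ∷ s) (suc j) = nth s j

nth-++ : ∀ s s′ {j} → j < length s → nth (s ++ s′) j ≡ nth s j
nth-++ (a ∷ s) s′ {zero}  _   = refl
nth-++ (a ∷ s) s′ {suc j} j<n = nth-++ s s′ (s<s⁻¹ j<n)

nth-↾ : ∀ (y : Baire) s → (∀ j → j < length s → nth s j ≡ y j) → y ↾ length s ≡ s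
nth-↾ y []      _  = refl
nth-↾ y (a ∷ s) eq = cong₂ _∷_ (sym (eq 0 z<s)) (nth-↾ (y ∘ suc) s λ j j<n → eq (suc j) (s<s j<n))

read : (δ : ℕ → Dir) → (∀ k → ∃[ m ] (k ≤ length (blocks (δ ↾ m)))) →
  ∃[ y ] (∀ m → y ↾ length (blocks (δ ↾ m)) ≡ blocks (δ ↾ m))
read δ long = y , λ m → nth-↾ y _ (agree m)
  where
  y : Baire
  y j = nth (blocks (δ ↾ proj₁ (long (suc j)))) j
  agree : ∀ m j → j < length (blocks (δ ↾ m)) → nth (blocks (δ ↾ m)) j ≡ y j
  agree m j j<n with long (suc j)
  ... | m′ , j<n′ with ≤-total m m′
  ...   | inj₁ m≤m′ = let s , eq = blocks-mono δ m≤m′ in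
            sym (trans (cong (λ u → nth u j) eq) (nth-++ (blocks (δ ↾ m)) s j<n))
  ...   | inj₂ m′≤m = let s , eq = blocks-mono δ m′≤m in
            trans (cong (λ u → nth u j) eq) (nth-++ (blocks (δ ↾ m′)) s j<n′)

mark : {P : Set} → Dec P → Fin 2
mark (yes _) = suc zero
mark (no _)  = zero

mark⁻ : {P : Set} (d : Dec P) → mark d ≡ suc zero → P
mark⁻ (yes p) _ = p

mark⁺ : {P : Set} (d : Dec P) → P → mark d ≡ suc zero
mark⁺ (yes _) _ = refl
mark⁺ (no ¬p) p = ⊥-elim (¬p p)

mark-cong : {P Q : Set} (p : Dec P) (q : Dec Q) → (P → Q) → (Q → P) → mark p ≡ mark q
mark-cong (yes p) q       to _    = sym (mark⁺ q (to p))
mark-cong (no ¬p) (yes q) _  from = ⊥-elim (¬p (from q))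
mark-cong (no _)  (no _)  _  _    = refl

module _ (em : ExcludedMiddle 0ℓ) {I : Set} (I-ranked : Ranked I) where
  open Ranked I-ranked

  module _ {B : Set} (R : (I → B) → Baire → Set) where

    Approx : (I → B) → List ℕ → Set
    Approx x s = ∃[ x′ ] ∃[ y′ ] (R x′ y′ × Agree (length s) x x′ × y′ ↾ length s ≡ s)

    Marked : (I → B) → Node → Set
    Marked x u = (∃[ u′ ] u ≡ u′ ∷ʳ r) × Approx x (blocks u)

    -- R is recovered from the tree because it is closed: the marks along the
    -- branch spelling y say that ever longer prefixes of (x , y) extend to R.
    approxTree : (I → B) → Tree (Fin 2)
    approxTree x u = mark (em {Marked x u})

    Marked-resp : ∀ x y u → Agree (length u) x y → Marked x u → Marked y u
    Marked-resp x y u x≈y (ends , x′ , y′ , Rx′y′ , x≈x′ , eq) =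
      ends , x′ , y′ , Rx′y′ ,
      (λ i i<n → trans (sym (x≈y i (<-≤-trans i<n (length-blocksFrom 0 u)))) (x≈x′ i i<n)) , eq

    approxTree-causal : Causal I-ranked approxTree
    approxTree-causal x y u x≈y =
      mark-cong em em (Marked-resp x y u x≈y) (Marked-resp y x u λ i i<n → sym (x≈y i i<n))

    R⇒approxTree : ∀ x y → R x y → approxTree x ∈ ℒ
    R⇒approxTree x y Rxy = from (ℒ⇔path (approxTree x)) (spell y , λ N →
      let m , m≥N , r! , eq = blocks-spell N y
          len = trans (cong length eq) (length-applyUpTo y (suc N))
      in suc m , m≤n⇒m≤1+n m≥N , mark⁺ em
        ( (spell y ↾ m , trans (sym (applyUpTo-∷ʳ (spell y) m)) (cong (spell y ↾ m ∷ʳ_) r!))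
        , x , y , Rxy , (λ _ _ → refl) , trans (cong (y ↾_) len) (sym eq)))

    approxTree⇒R : IsClosed R → ∀ x → approxTree x ∈ ℒ → ∃ (R x)
    approxTree⇒R closed x x∈ℒ with δ , inf ← to (ℒ⇔path (approxTree x)) x∈ℒ =
      y , closed-limit I-ranked em closed x y approx
      where
      marked : ∀ N → ∃[ m ] (m ≥ N × Marked x (δ ↾ m))
      marked N = let m , m≥N , eq = inf N in m , m≥N , mark⁻ em eq

      longMarked : ∀ k → ∃[ m ] (k ≤ length (blocks (δ ↾ m)) × Marked x (δ ↾ m))
      longMarked zero = let m , _ , mk = marked 0 in m , z≤n , mk
      longMarked (suc k) with m , k≤n , _ ← longMarked k
        with suc m′ , m′>m , mk@((u′ , eq) , _) ← marked (suc m) = suc m′ , k<n , mk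
        where
        u′≡ : δ ↾ m′ ≡ u′ × δ m′ ≡ r
        u′≡ = ∷ʳ-injective _ _ (trans (applyUpTo-∷ʳ δ m′) eq)
        k<n : suc k ≤ length (blocks (δ ↾ suc m′))
        k<n with s , eq′ ← blocks-mono δ (s≤s⁻¹ m′>m) = begin
          suc k                              ≤⟨ s≤s k≤n ⟩
          suc (length (blocks (δ ↾ m)))      ≤⟨ s≤s (m≤m+n _ _) ⟩
          suc (length (blocks (δ ↾ m)) + length s) ≡⟨ cong suc (sym (trans (cong length eq′) (length-++ (blocks (δ ↾ m))))) ⟩
          suc (length (blocks (δ ↾ m′)))     ≡⟨ sym (blocks-∷ʳr (δ ↾ m′)) ⟩
          length (blocks (δ ↾ m′ ∷ʳ r))      ≡⟨ cong (λ d → length (blocks (δ ↾ m′ ∷ʳ d))) (sym (proj₂ u′≡)) ⟩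
          length (blocks (δ ↾ m′ ∷ʳ δ m′))   ≡⟨ cong (length ∘ blocks) (applyUpTo-∷ʳ δ m′) ⟩
          length (blocks (δ ↾ suc m′))       ∎
          where open ≤-Reasoning

      label : ∃[ y ] (∀ m → y ↾ length (blocks (δ ↾ m)) ≡ blocks (δ ↾ m))
      label = read δ λ k → let m , k≤n , _ = longMarked k in m , k≤n
      y : Baire
      y = proj₁ label

      approx : ∀ k → ∃[ x′ ] ∃[ y′ ] (R x′ y′ × Agree k x x′ × y ↾ k ≡ y′ ↾ k)
      approx k with m , k≤n , _ , x′ , y′ , Rx′y′ , x≈x′ , eq ← longMarked k =
        x′ , y′ , Rx′y′ , (λ i i<k → x≈x′ i (<-≤-trans i<k k≤n)) ,
        ↾-cong k λ i i<k → ↾-injective _ (trans (proj₂ label m) (sym eq)) i (<-≤-trans i<k k≤n)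

-- The prefix code a ↦ node a

parse : (n : ℕ) → Node → Maybe (Vec ℕ n × Node)
parseFrom : ℕ → (n : ℕ) → Node → Maybe (Vec ℕ (suc n) × Node)

parse zero    u = just ([] , u)
parse (suc n) u = parseFrom 0 n u

parseFrom c n []      = nothing
parseFrom c n (l ∷ u) = parseFrom (suc c) n u
parseFrom c n (r ∷ u) = Maybe.map (map₁ (c ∷_)) (parse n u)

parse-node : ∀ {n} (a : Vec ℕ n) w → parse n (node a ++ w) ≡ just (a , w)
parseFrom-node : ∀ {n} c k (a : Vec ℕ n) w →
  parseFrom c n ((replicate k l ++ r ∷ node a) ++ w) ≡ just (k + c ∷ a , w)

parse-node []       w = refl
parse-node (k ∷ a) w =
  trans (parseFrom-node 0 k a w) (cong (λ k′ → just (k′ ∷ a , w)) (+-identityʳ k))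

parseFrom-node c zero    a w = cong (Maybe.map (map₁ (c ∷_))) (parse-node a w)
parseFrom-node c (suc k) a w =
  trans (parseFrom-node (suc c) k a w) (cong (λ k′ → just (k′ ∷ a , w)) (m+1+n≡1+m+n k c))

parse-sound : ∀ n u {a w} → parse n u ≡ just (a , w) → u ≡ node a ++ w
parseFrom-sound : ∀ c n u {a w} → parseFrom c n u ≡ just (a , w) →
  replicate c l ++ u ≡ node a ++ w

parse-sound zero    u refl = refl
parse-sound (suc n) u eq   = parseFrom-sound 0 n u eq

parseFrom-sound c n (l ∷ u) eq = trans (replicate-l c) (parseFrom-sound (suc c) n u eq)
  where
  replicate-l : ∀ c → replicate c l ++ l ∷ u ≡ l ∷ replicate c l ++ u
  replicate-l zero    = refl
  replicate-l (suc c) = cong (l ∷_) (replicate-l c)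
parseFrom-sound c n (r ∷ u) eq with parse n u in eq′
parseFrom-sound c n (r ∷ u) refl | just (a , w) =
  trans (cong (λ v → replicate c l ++ r ∷ v) (parse-sound n u eq′))
        (sym (++-assoc (replicate c l) (r ∷ node a) w))

parse-++ : ∀ n u v {a w} → parse n u ≡ just (a , w) → parse n (u ++ v) ≡ just (a , w ++ v)
parse-++ n u v {a} {w} eq with refl ← parse-sound n u eq =
  trans (cong (parse n) (++-assoc (node a) w v)) (parse-node a (w ++ v))

graft : ∀ {n} → (Ordinal n → Tree (Fin 2)) → Tree (Fin 2)
graft {n} s u = maybe′ (λ (a , w) → s a w) zero (parse n u)

subtree-graft : ∀ {n} (s : Ordinal n → Tree (Fin 2)) a w → subtree (graft s) (node a) w ≡ s a w
subtree-graft s a w = cong (maybe′ (λ (a , w) → s a w) zero) (parse-node a w)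

analytic⇒subtree∈ℒ : (em : ExcludedMiddle 0ℓ) {I : Set} (I-ranked : Ranked I) {B : Set} {n : ℕ}
  (A : Ordinal n → Pred (I → B) 0ℓ) → (∀ a → Analytic (A a)) →
  Σ[ f ∈ ((I → B) → Tree (Fin 2)) ]
    (Causal I-ranked f × (∀ x a → x ∈ A a ⇔ subtree (f x) (node a) ∈ ℒ))
analytic⇒subtree∈ℒ em {I} I-ranked {B} {n} A analytic = f , causal , λ x a →
  let R , closed , A⇔R = analytic a in mk⇔
    (λ x∈A → let y , Rxy = to (A⇔R x) x∈A in
      ℒ-resp (λ w → sym (subtree-graft (trees x) a w)) (R⇒approxTree em I-ranked R x y Rxy))
    (λ t∈ℒ → from (A⇔R x)
      (approxTree⇒R em I-ranked R closed x (ℒ-resp (subtree-graft (trees x) a) t∈ℒ)))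
  where
  trees : (I → B) → Ordinal n → Tree (Fin 2)
  trees x a = approxTree em I-ranked (proj₁ (analytic a)) x
  f : (I → B) → Tree (Fin 2)
  f x = graft (trees x)
  causal : Causal I-ranked f
  causal x y u x≈y with parse n u in eq
  ... | nothing      = refl
  ... | just (a , w) = approxTree-causal em I-ranked _ x y w λ i i<n → x≈y i (<-≤-trans i<n (begin
      length w                   ≤⟨ m≤n+m _ _ ⟩
      length (node a) + length w ≡⟨ sym (length-++ (node a)) ⟩
      length (node a ++ w)       ≡⟨ sym (cong length (parse-sound n u eq)) ⟩
      length u                   ∎))
    where open ≤-Reasoning

-- Plays of parity games with priorities 0, 1, 2

Winning : (ℕ → Fin 3) → Set
Winning p = ∃[ m ] (IsLimsup (toℕ ∘ p) m × 2 ∣ m)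

Winning-resp : {p q : ℕ → Fin 3} → (∀ k → p k ≡ q k) → Winning p → Winning q
Winning-resp p≡q (m , ((N , le) , inf) , even) = m , ((N , λ k k≥N → subst (λ i → toℕ i ≤ m) (p≡q k) (le k k≥N)) ,
  λ M → let k , k≥M , eq = inf M in k , k≥M , trans (cong toℕ (sym (p≡q k))) eq) , even

Winning-tail⁺ : (p : ℕ → Fin 3) (c : ℕ) → Winning p → Winning (p ∘ (c +_))
Winning-tail⁺ p c (m , ((N , le) , inf) , even) =
  m , ((N , λ k k≥N → le (c + k) (≤-trans k≥N (m≤n+m k c))) , inf′) , even
  where
  inf′ : Infinitely (λ k → toℕ (p (c + k)) ≡ m)
  inf′ M with k , k≥ , eq ← inf (c + M) with j , refl ← m≤n⇒∃[o]m+o≡n (≤-trans (m≤m+n c M) k≥) =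
    j , +-cancelˡ-≤ c M j k≥ , eq

Winning-tail⁻ : (p : ℕ → Fin 3) (c : ℕ) → Winning (p ∘ (c +_)) → Winning p
Winning-tail⁻ p c (m , ((N , le) , inf) , even) =
  m , ((c + N , le′) , λ M → let k , k≥M , eq = inf M in c + k , ≤-trans k≥M (m≤n+m k c) , eq) , even
  where
  le′ : ∀ k → k ≥ c + N → toℕ (p k) ≤ m
  le′ k k≥ with j , refl ← m≤n⇒∃[o]m+o≡n (≤-trans (m≤m+n c N) k≥) = le j (+-cancelˡ-≤ c N j k≥)

infinitely2⇒Winning : {p : ℕ → Fin 3} → Infinitely (λ k → p k ≡ suc (suc zero)) → Winning p
infinitely2⇒Winning {p} inf = 2 , ((0 , λ k _ → toℕ≤pred[n] (p k)) ,
  λ N → let k , k≥N , eq = inf N in k , k≥N , cong toℕ eq) , divides 1 refl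

eventually0⇒Winning : {p : ℕ → Fin 3} (N : ℕ) → (∀ k → k ≥ N → p k ≡ zero) → Winning p
eventually0⇒Winning N p≡0 = 0 , ((N , λ k k≥N → ≤-reflexive (cong toℕ (p≡0 k k≥N))) ,
  λ M → M ⊔ N , m≤m⊔n M N , cong toℕ (p≡0 (M ⊔ N) (m≤n⊔m M N))) , divides 0 refl

Winning⇒infinitely2 : {p : ℕ → Fin 3} → Winning p → (∀ k → p k ≢ zero) →
  Infinitely (λ k → p k ≡ suc (suc zero))
Winning⇒infinitely2 {p} (m , (_ , inf) , even) p≢0 N with k , k≥N , refl ← inf N = k , k≥N , two (p k) (p≢0 k) even
  where
  two : (i : Fin 3) → i ≢ zero → 2 ∣ toℕ i → i ≡ suc (suc zero)
  two zero             i≢0 _ = ⊥-elim (i≢0 refl)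
  two (suc zero)       _ 2∣1 with () ← ∣1⇒≡1 2∣1
  two (suc (suc zero)) _ _   = refl

Winning⇒¬infinitely1 : {p : ℕ → Fin 3} → Winning p → (∀ k → p k ≢ suc (suc zero)) →
  ¬ Infinitely (λ k → p k ≡ suc zero)
Winning⇒¬infinitely1 {p} (m , ((N , le) , inf) , even) p≢2 inf1
  with k , _ , refl ← inf 0 | j , j≥N , eq ← inf1 N =
  n≮0 (subst₂ _≤_ (cong toℕ eq) (cong toℕ (zero! (p k) (p≢2 k) even)) (le j j≥N))
  where
  zero! : (i : Fin 3) → i ≢ suc (suc zero) → 2 ∣ toℕ i → i ≡ zero
  zero! zero             _ _   = refl
  zero! (suc zero)       _ 2∣1 with () ← ∣1⇒≡1 2∣1
  zero! (suc (suc zero)) i≢2 _ = ⊥-elim (i≢2 refl)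

FollowsPath : Tree Σ₍₀,₂₎ → Strategy → (ℕ → Dir) → Set
FollowsPath t σ δ = ∀ k → proj₁ (t (δ ↾ k)) ≡ Eve → δ k ≡ σ (δ ↾ k)

W⇔path : (t : Tree Σ₍₀,₂₎) → t ∈ W₍₀,₂₎ ⇔
  (Σ[ σ ∈ Strategy ] (∀ δ → FollowsPath t σ δ → Winning (λ k → proj₂ (t (δ ↾ k)))))
W⇔path t = mk⇔
  (λ (σ , win) → σ , λ δ fol → win (δ ↾_) (path-isBranch δ) λ k eve →
    trans (sym (applyUpTo-∷ʳ δ k)) (cong (δ ↾ k ∷ʳ_) (fol k eve)))
  (λ (σ , win) → σ , λ v br fol → let δ , v≡δ = branch-path br in
    Winning-resp (λ k → cong (proj₂ ∘ t) (sym (v≡δ k))) (win δ λ k eve →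
      ∷ʳ-injectiveʳ (δ ↾ k) (δ ↾ k) (begin
        δ ↾ k ∷ʳ δ k       ≡⟨ applyUpTo-∷ʳ δ k ⟩
        δ ↾ suc k          ≡⟨ sym (v≡δ (suc k)) ⟩
        v (suc k)          ≡⟨ fol k (trans (cong (proj₁ ∘ t) (v≡δ k)) eve) ⟩
        v k ∷ʳ σ (v k)     ≡⟨ cong (λ u → u ∷ʳ σ u) (v≡δ k) ⟩
        δ ↾ k ∷ʳ σ (δ ↾ k) ∎)))
  where open ≡-Reasoning

W-resp : {s t : Tree Σ₍₀,₂₎} → (∀ u → s u ≡ t u) → s ∈ W₍₀,₂₎ → t ∈ W₍₀,₂₎
W-resp s≡t (σ , win) = σ , λ v br fol →
  Winning-resp (λ k → cong proj₂ (s≡t (v k)))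
    (win v br λ k eve → fol k (trans (cong proj₁ (sym (s≡t (v k)))) eve))

run : Strategy → Node → ℕ → Dir
run σ u zero    = σ u
run σ u (suc k) = run σ (u ∷ʳ σ u) k

run-obeys : ∀ σ u k → run σ u k ≡ σ (u ++ run σ u ↾ k)
run-obeys σ u zero    = cong σ (sym (++-identityʳ u))
run-obeys σ u (suc k) = trans (run-obeys σ (u ∷ʳ σ u) k) (cong σ (++-assoc u [ σ u ] _))

↾-prefix : {A : Set} (f : ℕ → A) (k : ℕ) (u v : List A) → f ↾ k ≡ u ++ v → f ↾ length u ≡ u
↾-prefix f k       []      v eq = refl
↾-prefix f (suc k) (a ∷ u) v eq =
  cong₂ _∷_ (proj₁ (∷-injective eq)) (↾-prefix (f ∘ suc) k u v (proj₂ (∷-injective eq)))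

↾-split : {A : Set} (f : ℕ → A) (u : List A) → f ↾ length u ≡ u →
  ∀ k → f ↾ (length u + k) ≡ u ++ (f ∘ (length u +_)) ↾ k
↾-split f u eq k = trans (↾-+ f (length u) k) (cong (_++ (f ∘ (length u +_)) ↾ k) eq)

parse-proper : ∀ {n} (a : Vec ℕ n) (f : ℕ → Dir) → f ↾ length (node a) ≡ node a →
  ∀ k → k < length (node a) → parse n (f ↾ k) ≡ nothing
parse-proper {n} a f eq k k<n with parse n (f ↾ k) in eq′
... | nothing      = refl
... | just (b , w) with j , k+j≡n ← m≤n⇒∃[o]m+o≡n k<n = ⊥-elim (absurd w (cong (Maybe.map proj₂) (begin
  just (b , w ++ v)                    ≡⟨ sym (parse-++ n (f ↾ k) v eq′) ⟩
  parse n (f ↾ k ++ v)                 ≡⟨ cong (parse n) (sym (↾-+ f k (suc j))) ⟩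
  parse n (f ↾ (k + suc j))            ≡⟨ cong (λ m → parse n (f ↾ m)) (trans (m+1+n≡1+m+n k j) k+j≡n) ⟩
  parse n (f ↾ length (node a))        ≡⟨ cong (parse n) (trans eq (sym (++-identityʳ _))) ⟩
  parse n (node a ++ [])               ≡⟨ parse-node a [] ⟩
  just (a , [])                        ∎)))
  where
  open ≡-Reasoning
  v : Node
  v = (f ∘ (k +_)) ↾ suc j
  absurd : ∀ w → just (w ++ v) ≢ just []
  absurd [] ()
  absurd (_ ∷ _) ()

-- ℒₙ n is FirstIn Odd; the diagonal argument needs the other parity as well.
FirstIn : ∀ {n} → Pred (Ordinal n) 0ℓ → Pred (Tree (Fin 2)) 0ℓ
FirstIn {n} P t = Σ[ a ∈ Ordinal n ] (subtree t (node a) ∈ ℒ × P a) ×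
            (∀ (b : Ordinal n) → b <ₒ a → subtree t (node b) ∉ ℒ)

accepted : {Q : Set} → Dec Q → Fin 2 → Fin 3
accepted (yes _) zero    = suc zero
accepted (yes _) (suc _) = suc (suc zero)
accepted (no _)  _       = suc zero

refuted : {Q : Set} → Dec Q → Fin 2 → Fin 3
refuted (yes _) zero    = zero
refuted (yes _) (suc _) = suc zero
refuted (no _)  _       = zero

accepted≢0 : {Q : Set} (d : Dec Q) (i : Fin 2) → accepted d i ≢ zero
accepted≢0 (yes _) zero    ()
accepted≢0 (yes _) (suc _) ()
accepted≢0 (no _)  _       ()

accepted≡2⁻ : {Q : Set} (d : Dec Q) (i : Fin 2) → accepted d i ≡ suc (suc zero) → Q × i ≡ suc zero
accepted≡2⁻ (yes q) (suc zero) _ = q , refl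

accepted≡2⁺ : {Q : Set} (d : Dec Q) → Q → accepted d (suc zero) ≡ suc (suc zero)
accepted≡2⁺ (yes _) _ = refl
accepted≡2⁺ (no ¬q) q = ⊥-elim (¬q q)

refuted≢2 : {Q : Set} (d : Dec Q) (i : Fin 2) → refuted d i ≢ suc (suc zero)
refuted≢2 (yes _) zero    ()
refuted≢2 (yes _) (suc _) ()
refuted≢2 (no _)  _       ()

refuted≡1 : {Q : Set} (d : Dec Q) → Q → refuted d (suc zero) ≡ suc zero
refuted≡1 (yes _) _ = refl
refuted≡1 (no ¬q) q = ⊥-elim (¬q q)

refuted≡0 : {Q : Set} (d : Dec Q) (i : Fin 2) → (Q → i ≢ suc zero) → refuted d i ≡ zero
refuted≡0 (yes _) zero       _   = refl
refuted≡0 (yes q) (suc zero) i≢1 = ⊥-elim (i≢1 q refl)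
refuted≡0 (no _)  _          _   = refl

module _ (em : ExcludedMiddle 0ℓ) {n : ℕ} where

  parse-path : (δ : ℕ → Dir) →
    (∀ k → parse n (δ ↾ k) ≡ nothing) ⊎ (∃[ a ] δ ↾ length (node {n} a) ≡ node a)
  parse-path δ with em {∃[ k ] ∃[ aw ] parse n (δ ↾ k) ≡ just aw}
  ... | yes (k , (a , w) , eq) = inj₂ (a , ↾-prefix δ k (node a) w (parse-sound n (δ ↾ k) eq))
  ... | no none = inj₁ λ k → unparsed k (parse n (δ ↾ k)) refl
    where
    unparsed : ∀ k m → parse n (δ ↾ k) ≡ m → parse n (δ ↾ k) ≡ nothing
    unparsed k nothing   eq = eq
    unparsed k (just aw) eq = ⊥-elim (none (k , aw , eq))

  module _ (P : Pred (Ordinal n) 0ℓ) where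

    refutation : Tree (Fin 2) → Ordinal n → Maybe (Ordinal n × Node) → Fin 3
    refutation t a nothing        = zero
    refutation t a (just (b , w)) = refuted (em {b <ₒ a}) (t (node b ++ w))

    -- Eve spells node a, claiming that a is the first ordinal whose subtree
    -- is in ℒ.  Adam then either goes left and lets her exhibit a branch of
    -- that subtree, or goes right, spells node b for some b < a and exhibits
    -- a branch of the subtree at node b.  Whoever spells forever loses.  After
    -- Eve's claim Adam moves once, so the label at u reads t up to level |u|.
    label : Tree (Fin 2) → Maybe (Ordinal n × Node) → Σ₍₀,₂₎
    label t nothing            = Eve , suc zero
    label t (just (a , []))    = Adam , zero
    label t (just (a , l ∷ w)) = Eve , accepted (em {P a}) (t (node a ++ w))
    label t (just (a , r ∷ w)) = Adam , refutation t a (parse n w)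

    game : Tree (Fin 2) → Tree Σ₍₀,₂₎
    game t u = label t (parse n u)

    game-node : ∀ t (a : Ordinal n) w → game t (node a ++ w) ≡ label t (just (a , w))
    game-node t a w = cong (label t) (parse-node a w)

    refutation-Winning : ∀ t a → (∀ (b : Ordinal n) → b <ₒ a → subtree t (node b) ∉ ℒ) →
      ∀ δ → Winning (λ k → refutation t a (parse n (δ ↾ k)))
    refutation-Winning t a none δ with parse-path δ
    ... | inj₁ unparsed = eventually0⇒Winning 0 λ k _ → cong (refutation t a) (unparsed k)
    ... | inj₂ (b , eq) = Winning-tail⁻ _ (length (node b)) (eventually0⇒Winning (proj₁ finite) λ k k≥N →
            trans (cong (refutation t a) (trans (cong (parse n) (↾-split δ (node b) eq k)) (parse-node b _)))
                  (refuted≡0 em (t (node b ++ ξ ↾ k)) λ b<a → proj₂ finite b<a k k≥N))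
      where
      ξ : ℕ → Dir
      ξ = δ ∘ (length (node b) +_)
      finite : ∃[ N ] (b <ₒ a → ∀ k → k ≥ N → t (node b ++ ξ ↾ k) ≢ suc zero)
      finite with em {∃[ N ] (b <ₒ a → ∀ k → k ≥ N → t (node b ++ ξ ↾ k) ≢ suc zero)}
      ... | yes fin = fin
      ... | no ¬fin = 0 , λ b<a _ _ _ → none b b<a (from (ℒ⇔path (subtree t (node b))) (ξ , λ N → often N))
        where
        often : Infinitely (λ k → subtree t (node b) (ξ ↾ k) ≡ suc zero)
        often N with em {∃[ k ] (k ≥ N × t (node b ++ ξ ↾ k) ≡ suc zero)}
        ... | yes found = found
        ... | no ¬found = ⊥-elim (¬fin (N , λ _ k k≥N eq → ¬found (k , k≥N , eq)))

    FirstIn⇒W : ∀ t → t ∈ FirstIn P → game t ∈ W₍₀,₂₎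
    FirstIn⇒W t (a , (a∈ℒ , Pa) , none) with δ , inf ← to (ℒ⇔path (subtree t (node a))) a∈ℒ =
      from (W⇔path (game t)) (σ , win)
      where
      β : ℕ → Dir
      β = node a ⊹ [ l ] ⊹ δ
      len : ℕ
      len = length (node a)

      σ : Strategy
      σ u = β (length u)

      β-spells : β ↾ len ≡ node a
      β-spells = subst (λ k → β ↾ k ≡ node a) (+-identityʳ len)
        (trans (⊹-↾ (node a) ([ l ] ⊹ δ) 0) (++-identityʳ (node a)))

      module _ (γ : ℕ → Dir) (fol : FollowsPath (game t) σ γ) where

        spells-upto : ∀ k → k ≤ len → γ ↾ k ≡ β ↾ k
        spells-upto zero    _   = refl
        spells-upto (suc k) k<n = begin
          γ ↾ suc k           ≡⟨ sym (applyUpTo-∷ʳ γ k) ⟩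
          γ ↾ k ∷ʳ γ k        ≡⟨ cong₂ _∷ʳ_ IH (trans (fol k eve) (cong β (length-applyUpTo γ k))) ⟩
          β ↾ k ∷ʳ β k        ≡⟨ applyUpTo-∷ʳ β k ⟩
          β ↾ suc k           ∎
          where
          open ≡-Reasoning
          IH : γ ↾ k ≡ β ↾ k
          IH = spells-upto k (<⇒≤ k<n)
          eve : proj₁ (game t (γ ↾ k)) ≡ Eve
          eve = cong (proj₁ ∘ label t) (trans (cong (parse n) IH) (parse-proper a β β-spells k k<n))

        spells : γ ↾ len ≡ node a
        spells = trans (spells-upto len ≤-refl) β-spells

        ξ : ℕ → Dir
        ξ = γ ∘ (len +_)

        position : ∀ k → game t (γ ↾ (len + k)) ≡ label t (just (a , ξ ↾ k))
        position k = trans (cong (game t) (↾-split γ (node a) spells k)) (game-node t a (ξ ↾ k))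

        accepting : ξ 0 ≡ l → ∀ k → ξ (suc k) ≡ δ k
        accepting ξ₀ k = begin
          γ (len + suc k)                   ≡⟨ fol (len + suc k) eve ⟩
          β (length (γ ↾ (len + suc k)))    ≡⟨ cong β (length-applyUpTo γ (len + suc k)) ⟩
          β (len + suc k)                   ≡⟨ ⊹-+ (node a) ([ l ] ⊹ δ) (suc k) ⟩
          δ k                               ∎
          where
          open ≡-Reasoning
          eve : proj₁ (game t (γ ↾ (len + suc k))) ≡ Eve
          eve = trans (cong proj₁ (position (suc k)))
                      (cong (λ d → proj₁ (label t (just (a , d ∷ (ξ ∘ suc) ↾ k)))) ξ₀)

        afterReply : (d : Dir) → ξ 0 ≡ d →
          Winning (λ k → proj₂ (label t (just (a , d ∷ (ξ ∘ suc) ↾ k))))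
        afterReply l ξ₀ = infinitely2⇒Winning λ N → let m , m≥N , eq = inf N in
          m , m≥N , trans
            (cong (accepted em) (trans (cong (λ w → t (node a ++ w)) (↾-cong m λ i _ → accepting ξ₀ i)) eq))
            (accepted≡2⁺ em Pa)
        afterReply r ξ₀ = refutation-Winning t a none (ξ ∘ suc)

        win : Winning (λ k → proj₂ (game t (γ ↾ k)))
        win = Winning-tail⁻ _ len (Winning-tail⁻ _ 1
          (Winning-resp (λ k → cong proj₂ (sym (position (suc k)))) (afterReply (ξ 0) refl)))

    W⇒FirstIn : ∀ t → game t ∈ W₍₀,₂₎ → t ∈ FirstIn P
    W⇒FirstIn t game∈W with σ , win ← to (W⇔path (game t)) game∈W
      with parse-path (run σ [])
    ... | inj₁ unparsed = ⊥-elim (neverWins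
            (Winning-resp (λ k → cong (proj₂ ∘ label t) (unparsed k)) (win (run σ []) λ k _ → run-obeys σ [] k)))
      where
      neverWins : ¬ Winning (λ _ → suc zero)
      neverWins w with _ , _ , () ← Winning⇒infinitely2 w (λ _ ()) 0
    ... | inj₂ (a , spells) = a , claim , refute
      where
      obeys⇒Winning : ∀ ξ → (∀ k → proj₁ (label t (just (a , ξ ↾ k))) ≡ Eve → ξ k ≡ σ (node a ++ ξ ↾ k)) →
        Winning (λ k → proj₂ (label t (just (a , ξ ↾ k))))
      obeys⇒Winning ξ obeys = Winning-resp
        (λ k → cong proj₂ (position k))
        (Winning-tail⁺ _ (length (node a)) (win (node a ⊹ ξ) follows))
        where
        position : ∀ k → game t ((node a ⊹ ξ) ↾ (length (node a) + k)) ≡ label t (just (a , ξ ↾ k))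
        position k = trans (cong (game t) (⊹-↾ (node a) ξ k)) (game-node t a (ξ ↾ k))

        follows : FollowsPath (game t) σ (node a ⊹ ξ)
        follows k eve with k <? length (node a)
        ... | yes k<n = trans (same k k<n) (trans (run-obeys σ [] k)
                (cong σ (sym (↾-cong k λ i i<k → same i (<-trans i<k k<n)))))
          where
          same : ∀ i → i < length (node a) → (node a ⊹ ξ) i ≡ run σ [] i
          same = ⊹-< (node a) ξ (run σ []) spells
        ... | no k≮n with j , refl ← m≤n⇒∃[o]m+o≡n (≮⇒≥ k≮n) =
          trans (⊹-+ (node a) ξ j) (trans (obeys j (trans (cong proj₁ (sym (position j))) eve))
            (cong σ (sym (⊹-↾ (node a) ξ j))))

      claim : subtree t (node a) ∈ ℒ × P a
      claim = from (ℒ⇔path (subtree t (node a))) (δ , λ N → let m , m≥N , eq = often N in m , m≥N , proj₂ (accepted≡2⁻ em _ eq))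
            , proj₁ (accepted≡2⁻ em _ (proj₂ (proj₂ (often 0))))
        where
        δ : ℕ → Dir
        δ = run σ (node a ∷ʳ l)
        obeys : ∀ k → proj₁ (label t (just (a , ([ l ] ⊹ δ) ↾ k))) ≡ Eve →
          ([ l ] ⊹ δ) k ≡ σ (node a ++ ([ l ] ⊹ δ) ↾ k)
        obeys (suc k) _ = trans (run-obeys σ (node a ∷ʳ l) k) (cong σ (++-assoc (node a) [ l ] _))
        often : Infinitely (λ k → accepted (em {P a}) (t (node a ++ δ ↾ k)) ≡ suc (suc zero))
        often = Winning⇒infinitely2 (Winning-tail⁺ _ 1 (obeys⇒Winning ([ l ] ⊹ δ) obeys))
          λ k → accepted≢0 (em {P a}) _

      refute : ∀ (b : Ordinal n) → b <ₒ a → subtree t (node b) ∉ ℒ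
      refute b b<a b∈ℒ with δ , inf ← to (ℒ⇔path (subtree t (node b))) b∈ℒ =
        Winning⇒¬infinitely1
          (Winning-resp (λ k → cong (refutation t a) (trans (cong (parse n) (⊹-↾ (node b) δ k)) (parse-node b (δ ↾ k))))
            (Winning-tail⁺ _ (length (node b)) (Winning-tail⁺ _ 1 (obeys⇒Winning ξ obeys))))
          (λ k → refuted≢2 em _)
          (λ N → let m , m≥N , eq = inf N in m , m≥N , trans (cong (refuted em) eq) (refuted≡1 em b<a))
        where
        ξ : ℕ → Dir
        ξ = [ r ] ⊹ node b ⊹ δ
        obeys : ∀ k → proj₁ (label t (just (a , ξ ↾ k))) ≡ Eve → ξ k ≡ σ (node a ++ ξ ↾ k)
        obeys zero    ()
        obeys (suc k) ()

    game-local : ∀ s t u → Ranked.Agree node-ranked (suc (length u)) s t → game s u ≡ game t u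
    game-local s t u s≡t with parse n u in eq
    ... | nothing           = refl
    ... | just (a , [])     = refl
    ... | just (a , l ∷ w)  = cong (λ i → Eve , accepted (em {P a}) i) (s≡t (node a ++ w)
            (s≤s (begin
              length (node a ++ w)          ≡⟨ length-++ (node a) ⟩
              length (node a) + length w    ≤⟨ +-monoʳ-≤ (length (node a)) (n≤1+n _) ⟩
              length (node a) + suc (length w) ≡⟨ sym (length-++ (node a)) ⟩
              length (node a ++ l ∷ w)      ≡⟨ sym (cong length (parse-sound n u eq)) ⟩
              length u                      ∎)))
      where open ≤-Reasoning
    ... | just (a , r ∷ w) with parse n w in eq′
    ...   | nothing       = refl
    ...   | just (b , w′) = cong (λ i → Adam , refuted (em {b <ₒ a}) i) (s≡t (node b ++ w′)
            (s≤s (begin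
              length (node b ++ w′)         ≡⟨ sym (cong length (parse-sound n w eq′)) ⟩
              length w                      ≤⟨ n≤1+n _ ⟩
              suc (length w)                ≤⟨ m≤n+m _ _ ⟩
              length (node a) + suc (length w) ≡⟨ sym (length-++ (node a)) ⟩
              length (node a ++ r ∷ w)      ≡⟨ sym (cong length (parse-sound n u eq)) ⟩
              length u                      ∎)))
      where open ≤-Reasoning

    FirstIn≤W : FirstIn P ≤W W₍₀,₂₎
    FirstIn≤W = game , modulus⇒continuous node-ranked game (suc ∘ length) game-local
              , λ t → mk⇔ (FirstIn⇒W t) (W⇒FirstIn t)

module _ {n : ℕ} where
  open IsStrictTotalOrder (Lex.<-isStrictTotalOrder <-isStrictTotalOrder {n}) public
    using () renaming (trans to <ₒ-trans; irrefl to <ₒ-irrefl′; compare to <ₒ-compare′)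

  <ₒ-irrefl : ∀ {a : Ordinal n} → ¬ a <ₒ a
  <ₒ-irrefl = <ₒ-irrefl′ (Pointwise.≡⇒Pointwise-≡ refl)

  <ₒ-connex : (a b : Ordinal n) → a <ₒ b ⊎ a ≡ b ⊎ b <ₒ a
  <ₒ-connex a b with <ₒ-compare′ a b
  ... | tri< a<b _ _ = inj₁ a<b
  ... | tri≈ _ a≈b _ = inj₂ (inj₁ (Pointwise.Pointwise-≡⇒≡ a≈b))
  ... | tri> _ _ b<a = inj₂ (inj₂ b<a)

  least : ExcludedMiddle 0ℓ → (Q : Pred (Ordinal n) 0ℓ) → ∀ {a} → Q a →
    ∃[ b ] (Q b × (∀ c → c <ₒ b → ¬ Q c))
  least em Q Qa = go Qa (Lex.<-wellFounded trans (λ { refl → id }) <-wellFounded _)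
    where
    go : ∀ {a} → Q a → Acc _<ₒ_ a → ∃[ b ] (Q b × (∀ c → c <ₒ b → ¬ Q c))
    go {a} Qa (acc rec) with em {∃[ c ] (c <ₒ a × Q c)}
    ... | yes (c , c<a , Qc) = go Qc (rec c<a)
    ... | no none            = a , Qa , λ c c<a Qc → none (c , c<a , Qc)

-- The parity of an ordinal below ω^n

<ₒ-0∷ : ∀ {n} {β : Ordinal (suc n)} {a : Ordinal n} → β <ₒ (0 ∷ a) → ∃[ b ] (β ≡ 0 ∷ b × b <ₒ a)
<ₒ-0∷ (Lex.next refl b<a) = _ , refl , b<a

≮-0s : ∀ n {b : Ordinal n} → ¬ b <ₒ Vec.replicate n 0
≮-0s zero    (Lex.base ())
≮-0s (suc n) (Lex.next _ b<0) = ≮-0s n b<0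

<ₒ-ω^ : ∀ {n} {θ : Ordinal (suc n)} → θ <ₒ ω^ n → ∃[ a ] θ ≡ 0 ∷ a
<ₒ-ω^     (Lex.this z<s _)    = _ , refl
<ₒ-ω^ {n} (Lex.next refl a<0) = ⊥-elim (≮-0s n a<0)

module _ {n : ℕ} where

  ⋖-0∷⁺ : {b a : Ordinal n} → b ⋖ a → (0 ∷ b) ⋖ (0 ∷ a)
  ⋖-0∷⁺ (b<a , none) = Lex.next refl b<a , between
    where
    between : ¬ (∃[ δ ] (0 ∷ _ <ₒ δ × δ <ₒ 0 ∷ _))
    between (δ , b<δ , δ<a) with d , refl , d<a ← <ₒ-0∷ δ<a | Lex.next _ b<d ← b<δ = none (d , b<d , d<a)

  ⋖-0∷⁻ : {β : Ordinal (suc n)} {a : Ordinal n} → β ⋖ (0 ∷ a) → ∃[ b ] (β ≡ 0 ∷ b × b ⋖ a)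
  ⋖-0∷⁻ (β<a , none) with b , refl , b<a ← <ₒ-0∷ β<a =
    b , refl , b<a , λ (d , b<d , d<a) → none (0 ∷ d , Lex.next refl b<d , Lex.next refl d<a)

  +-0∷⁺ : ∀ {γ a : Ordinal n} {m} → γ + m ≐ₒ a → (0 ∷ γ) + m ≐ₒ (0 ∷ a)
  +-0∷⁺ +-zero        = +-zero
  +-0∷⁺ (+-suc p b⋖a) = +-suc (+-0∷⁺ p) (⋖-0∷⁺ b⋖a)

  +-0∷⁻ : ∀ {γ : Ordinal (suc n)} {a : Ordinal n} {m} → γ + m ≐ₒ (0 ∷ a) → ∃[ c ] (γ ≡ 0 ∷ c × c + m ≐ₒ a)
  +-0∷⁻ +-zero = _ , refl , +-zero
  +-0∷⁻ (+-suc p β⋖a) with b , refl , b⋖a ← ⋖-0∷⁻ β⋖a =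
    let c , eq , q = +-0∷⁻ p in c , eq , +-suc q b⋖a

  Even-0∷ : (a : Ordinal n) → Even (0 ∷ a) ⇔ Even a
  Even-0∷ a = mk⇔ uncons cons
    where
    uncons : Even (0 ∷ a) → Even a
    uncons (γ , m , limit , p , even) with c , refl , q ← +-0∷⁻ p =
      c , m , (λ (b , b⋖c) → limit (0 ∷ b , ⋖-0∷⁺ b⋖c)) , q , even
    cons : Even a → Even (0 ∷ a)
    cons (c , m , limit , q , even) =
      0 ∷ c , m , (λ (β , β⋖c) → let b , _ , b⋖c = ⋖-0∷⁻ β⋖c in limit (b , b⋖c)) , +-0∷⁺ q , even

ω^-even : ∀ n → Even (ω^ suc n)
ω^-even n = ω^ suc n , 0 , limit , +-zero , divides 0 refl
  where
  limit : ZeroOrLimit (ω^ suc n)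
  limit (β , β<ω , none) with (a ∷ as) , refl ← <ₒ-ω^ β<ω =
    none (0 ∷ suc a ∷ as , Lex.next refl (Lex.this (n<1+n a) refl) , Lex.this z<s refl)

opposite-ω^ : ∀ n (a : Ordinal (suc n)) → OppositeParity (0 ∷ a) (ω^ suc n) ⇔ Odd a
opposite-ω^ n a = mk⇔ opp⇒odd (λ odd → inj₁ (odd ∘ to (Even-0∷ a) , ω^-even n))
  where
  opp⇒odd : OppositeParity (0 ∷ a) (ω^ suc n) → Odd a
  opp⇒odd (inj₁ (odd , _)) = odd ∘ from (Even-0∷ a)
  opp⇒odd (inj₂ (_ , odd)) = ⊥-elim (odd (ω^-even n))

-- Completeness of ℒₙ

decode : ℕ → Dir × ℕ
decode 0             = l , 0
decode 1             = r , 0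
decode (suc (suc c)) = map₂ suc (decode c)

decode-surjective : ∀ d m → ∃[ c ] decode c ≡ (d , m)
decode-surjective l zero    = 0 , refl
decode-surjective r zero    = 1 , refl
decode-surjective d (suc m) = let c , eq = decode-surjective d m in suc (suc c) , cong (map₂ suc) eq

firstₙ : (n : ℕ) → Baire → Vec ℕ n
firstₙ zero    y = []
firstₙ (suc n) y = y 0 ∷ firstₙ n (y ∘ suc)

firstₙ-cong : ∀ n {y z : Baire} → (∀ i → i < n → y i ≡ z i) → firstₙ n y ≡ firstₙ n z
firstₙ-cong zero    y≡z = refl
firstₙ-cong (suc n) y≡z = cong₂ _∷_ (y≡z 0 z<s) (firstₙ-cong n λ i i<n → y≡z (suc i) (s<s i<n))

firstₙ-⊹ : ∀ {n} (b : Vec ℕ n) z → firstₙ n (toList b ⊹ z) ≡ b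
firstₙ-⊹ []      z = refl
firstₙ-⊹ (a ∷ b) z = cong (a ∷_) (firstₙ-⊹ b z)

toList-⊹ : ∀ {n} (b : Vec ℕ n) (z : Baire) i → (toList b ⊹ z) (n + i) ≡ z i
toList-⊹ []      z i = refl
toList-⊹ (a ∷ b) z i = toList-⊹ b z i

module _ (em : ExcludedMiddle 0ℓ) {I B : Set} {n : ℕ}
  (f : (I → B) → Tree (Fin 2)) (f-continuous : Continuous f) (Q : Pred (Ordinal n) 0ℓ) where

  -- A witness y lists b, then at position n + i the i-th direction of a
  -- branch together with a level beyond i at which the branch carries a 1.
  private
    dir : Baire → ℕ → Dir
    dir y i = proj₁ (decode (y (n + i)))

    level : Baire → ℕ → ℕ
    level y i = proj₂ (decode (y (n + i)))

    Hit : (I → B) → Baire → ℕ → Set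
    Hit x y i = level y i ≥ i × f x (node (firstₙ n y) ++ dir y ↾ level y i) ≡ suc zero

    R : (I → B) → Baire → Set
    R x y = Q (firstₙ n y) × (∀ i → Hit x y i)

    R-closed : IsClosed R
    R-closed x y ¬R with em {Q (firstₙ n y)} | em {∃[ i ] ¬ Hit x y i}
    ... | no ¬Q | _ = [] , upTo n , λ x′ y′ _ y≈ (Qb , _) →
            ¬Q (subst Q (sym (firstₙ-cong n λ i i<n → All.lookup y≈ (∈-upTo⁺ i<n))) Qb)
    ... | yes Qb | no none = ⊥-elim (¬R (Qb , λ i → hit i em))
      where
      hit : ∀ i → Dec (Hit x y i) → Hit x y i
      hit i (yes h) = h
      hit i (no ¬h) = ⊥-elim (none (i , ¬h))
    ... | yes _ | yes (i , ¬hit) =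
      let F , f-local = f-continuous x [ node (firstₙ n y) ++ dir y ↾ level y i ]
      in F , upTo (n + (suc i ⊔ level y i)) , λ x′ y′ x≈ y≈ (_ , hits) →
        let same : ∀ j → j < n + (suc i ⊔ level y i) → y j ≡ y′ j
            same j j< = All.lookup y≈ (∈-upTo⁺ j<)
            level≡ : level y′ i ≡ level y i
            level≡ = cong (proj₂ ∘ decode) (sym (same (n + i) (+-monoʳ-< n (m≤m⊔n (suc i) (level y i)))))
            dirs≡ : dir y′ ↾ level y′ i ≡ dir y ↾ level y i
            dirs≡ = trans (cong (dir y′ ↾_) level≡) (↾-cong (level y i) λ j j< →
              cong (proj₁ ∘ decode) (sym (same (n + j) (+-monoʳ-< n (<-≤-trans j< (m≤n⊔m (suc i) _))))))
            first≡ : firstₙ n y′ ≡ firstₙ n y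
            first≡ = sym (firstₙ-cong n λ j j<n → same j (<-≤-trans j<n (m≤m+n n _)))
            above , eq = hits i
        in ¬hit (subst (_≥ i) level≡ above ,
             trans (All.head (f-local x′ x≈))
               (trans (cong₂ (λ b u → f x′ (node b ++ u)) (sym first≡) (sym dirs≡)) eq))

  analytic-hits : Analytic (λ x → ∃[ b ] (Q b × subtree (f x) (node b) ∈ ℒ))
  analytic-hits = R , R-closed , λ x → mk⇔ (⇒R x) (R⇒ x)
    where
    R⇒ : ∀ x → ∃ (R x) → ∃[ b ] (Q b × subtree (f x) (node b) ∈ ℒ)
    R⇒ x (y , Qb , hits) = firstₙ n y , Qb , from (ℒ⇔path (subtree (f x) (node (firstₙ n y))))
      (dir y , λ N → level y N , hits N)

    ⇒R : ∀ x → ∃[ b ] (Q b × subtree (f x) (node b) ∈ ℒ) → ∃ (R x)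
    ⇒R x (b , Qb , b∈ℒ) with δ , inf ← to (ℒ⇔path (subtree (f x) (node b))) b∈ℒ =
      y , subst Q (sym (firstₙ-⊹ b z)) Qb , hits
      where
      z : Baire
      z i = proj₁ (decode-surjective (δ i) (proj₁ (inf i)))
      y : Baire
      y = toList b ⊹ z
      decode-y : ∀ i → decode (y (n + i)) ≡ (δ i , proj₁ (inf i))
      decode-y i = trans (cong decode (toList-⊹ b z i)) (proj₂ (decode-surjective (δ i) (proj₁ (inf i))))
      hits : ∀ i → Hit x y i
      hits i = subst (_≥ i) (sym level≡) (proj₁ (proj₂ (inf i))) ,
        trans (cong₂ (λ b u → f x (node b ++ u)) (firstₙ-⊹ b z)
                (trans (cong (dir y ↾_) level≡) (↾-cong _ λ j _ → cong proj₁ (decode-y j))))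
              (proj₂ (proj₂ (inf i)))
        where
        level≡ : level y i ≡ proj₁ (inf i)
        level≡ = cong proj₂ (decode-y i)

Diff-ω^⇔ℒₙ : ∀ {n} {X : Set} (A : Ordinal (suc (suc n)) → Pred X 0ℓ) (f : X → Tree (Fin 2)) →
  (∀ x (a : Ordinal (suc n)) → x ∈ A (0 ∷ a) ⇔ subtree (f x) (node a) ∈ ℒ) →
  ∀ x → x ∈ Diff (ω^ suc n) A ⇔ f x ∈ ℒₙ (suc n)
Diff-ω^⇔ℒₙ {n} A f A⇔ x = mk⇔ ⇒ ⇐
  where
  ⇒ : x ∈ Diff (ω^ suc n) A → f x ∈ ℒₙ (suc n)
  ⇒ (θ , θ<ω , opp , x∈A , none) with a , refl ← <ₒ-ω^ θ<ω =
    a , (to (A⇔ x a) x∈A , to (opposite-ω^ n a) opp) ,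
    λ b b<a b∈ℒ → none (0 ∷ b) (Lex.next refl b<a) (from (A⇔ x b) b∈ℒ)
  ⇐ : f x ∈ ℒₙ (suc n) → x ∈ Diff (ω^ suc n) A
  ⇐ (a , (a∈ℒ , odd) , none) =
    0 ∷ a , Lex.this z<s refl , from (opposite-ω^ n a) odd , from (A⇔ x a) a∈ℒ , none′
    where
    none′ : ∀ θ → θ <ₒ (0 ∷ a) → x ∉ A θ
    none′ θ θ<a x∈A with b , refl , b<a ← <ₒ-0∷ θ<a = none b b<a (to (A⇔ x b) x∈A)

ℒₙ-complete : ExcludedMiddle 0ℓ → ∀ n → Complete (ω^ suc n) (ℒₙ (suc n))
ℒₙ-complete em n _ Y _ E = mk⇔ D⇒≤W ≤W⇒D
  where
  D⇒≤W : E ∈ D (ω^ suc n) → E ≤W ℒₙ (suc n)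
  D⇒≤W (A , analytic , _ , E⊆Diff , Diff⊆E) =
    let f , causal , A⇔ = analytic⇒subtree∈ℒ em ℕ-ranked (λ a → A (0 ∷ a))
                            (λ a → analytic (0 ∷ a) (Lex.this z<s refl))
        Diff⇔ = Diff-ω^⇔ℒₙ A f A⇔
    in f , modulus⇒continuous ℕ-ranked f length causal ,
       λ x → mk⇔ (λ x∈E → to (Diff⇔ x) (E⊆Diff x∈E)) (λ t∈ℒₙ → Diff⊆E (from (Diff⇔ x) t∈ℒₙ))

  ≤W⇒D : E ≤W ℒₙ (suc n) → E ∈ D (ω^ suc n)
  ≤W⇒D (f , f-continuous , E⇔) = A , (λ θ _ → analytic-hits em f f-continuous (upTo-tail θ)) , mono ,
    (λ {x} x∈E → ⇒ x (to (E⇔ x) x∈E)) , (λ {x} x∈Diff → from (E⇔ x) (⇐ x x∈Diff))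
    where
    upTo-tail : Ordinal (suc (suc n)) → Pred (Ordinal (suc n)) 0ℓ
    upTo-tail (_ ∷ a) b = b <ₒ a ⊎ b ≡ a

    A : Ordinal (suc (suc n)) → Pred (Word Y) 0ℓ
    A θ x = ∃[ b ] (upTo-tail θ b × subtree (f x) (node b) ∈ ℒ)

    mono : ∀ θ θ′ → θ <ₒ θ′ → θ′ <ₒ ω^ suc n → ∀ {x} → x ∈ A θ → x ∈ A θ′
    mono θ θ′ θ<θ′ θ′<ω (b , b≤ , b∈ℒ) with a′ , refl ← <ₒ-ω^ θ′<ω with a , refl , a<a′ ← <ₒ-0∷ θ<θ′ =
      b , inj₁ (below b≤) , b∈ℒ
      where
      below : b <ₒ a ⊎ b ≡ a → b <ₒ a′
      below (inj₁ b<a) = <ₒ-trans b<a a<a′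
      below (inj₂ refl) = a<a′

    ⇒ : ∀ x → f x ∈ ℒₙ (suc n) → x ∈ Diff (ω^ suc n) A
    ⇒ x (a , (a∈ℒ , odd) , none) =
      0 ∷ a , Lex.this z<s refl , from (opposite-ω^ n a) odd , (a , inj₂ refl , a∈ℒ) , none′
      where
      none′ : ∀ θ → θ <ₒ (0 ∷ a) → x ∉ A θ
      none′ θ θ<a (b , b≤ , b∈ℒ) with a′ , refl , a′<a ← <ₒ-0∷ θ<a = none b (below b≤) b∈ℒ
        where
        below : b <ₒ a′ ⊎ b ≡ a′ → b <ₒ a
        below (inj₁ b<a′) = <ₒ-trans b<a′ a′<a
        below (inj₂ refl) = a′<a

    ⇐ : ∀ x → x ∈ Diff (ω^ suc n) A → f x ∈ ℒₙ (suc n)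
    ⇐ x (θ , θ<ω , opp , x∈A , none) with a , refl ← <ₒ-ω^ θ<ω = first x∈A
      where
      none′ : ∀ b → b <ₒ a → subtree (f x) (node b) ∉ ℒ
      none′ b b<a b∈ℒ = none (0 ∷ b) (Lex.next refl b<a) (b , inj₂ refl , b∈ℒ)
      first : x ∈ A (0 ∷ a) → f x ∈ ℒₙ (suc n)
      first (b , inj₁ b<a  , b∈ℒ) = ⊥-elim (none′ b b<a b∈ℒ)
      first (b , inj₂ refl , b∈ℒ) = b , (b∈ℒ , to (opposite-ω^ n b) opp) , none′

-- The diagonal argument

module _ {B : Set} (f : Tree B → Tree B) (causal : Causal node-ranked f) (t₀ : Tree B) where
  open Ranked node-ranked

  private
    iterate : ℕ → Tree B
    iterate zero    = t₀
    iterate (suc k) = f (iterate k)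

    iterate-step : ∀ k → Agree k (iterate k) (iterate (suc k))
    iterate-step (suc k) u u<k = causal _ _ u λ v v<u → iterate-step k v (<-≤-trans v<u (s≤s⁻¹ u<k))

    fixedPoint : Tree B
    fixedPoint u = iterate (suc (length u)) u

    iterate-stable : ∀ u j → fixedPoint u ≡ iterate (suc (length u) + j) u
    iterate-stable u zero    = cong (λ k → iterate k u) (sym (+-identityʳ (suc (length u))))
    iterate-stable u (suc j) = trans (iterate-stable u j) (trans
      (iterate-step (suc (length u) + j) u (m≤m+n _ j))
      (cong (λ k → iterate k u) (sym (m+1+n≡1+m+n (suc (length u)) j))))

  causal⇒fixedPoint : ∃[ t ] (∀ u → f t u ≡ t u)
  causal⇒fixedPoint = fixedPoint , λ u → causal fixedPoint (iterate (length u)) u (agree u)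
    where
    agree : ∀ u → Agree (length u) fixedPoint (iterate (length u))
    agree u v v<u with j , eq ← m≤n⇒∃[o]m+o≡n v<u = trans (iterate-stable v j) (cong (λ k → iterate k v) eq)

module _ (em : ExcludedMiddle 0ℓ) {k : ℕ} (α : Ordinal k) where

  SameParity : Pred (Ordinal k) 0ℓ
  SameParity a = ¬ OppositeParity a α

  same-parity : SameParity α
  same-parity (inj₁ (odd , even)) = odd even
  same-parity (inj₂ (even , odd)) = odd even

  -- From α on the sets are the whole space, so every point has a first
  -- ordinal, and complementing a difference means reversing its parity.
  extend : {X : Set} → (Ordinal k → Pred X 0ℓ) → Ordinal k → Pred X 0ℓ
  extend A a x = a <ₒ α → x ∈ A a

  extend-analytic : {I B : Set} (A : Ordinal k → Pred (I → B) 0ℓ) →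
    (∀ a → a <ₒ α → Analytic (A a)) → ∀ a → Analytic (extend A a)
  extend-analytic A analytic a with em {a <ₒ α}
  ... | yes a<α = let R , closed , A⇔ = analytic a a<α in
          R , closed , λ x → mk⇔ (λ x∈ → to (A⇔ x) (x∈ a<α)) (λ R∃ _ → from (A⇔ x) R∃)
  ... | no a≮α  = (λ _ _ → ⊤) , (λ _ _ ¬tt → ⊥-elim (¬tt tt)) ,
          λ x → mk⇔ (λ _ → (λ _ → 0) , tt) (λ _ a<α → ⊥-elim (a≮α a<α))

  W∈D⇒no-fixedPoint : (A : Ordinal k → Pred (Tree Σ₍₀,₂₎) 0ℓ) → W₍₀,₂₎ ≐ Diff α A →
    (f : Tree Σ₍₀,₂₎ → Tree (Fin 2)) → (∀ x a → x ∈ extend A a ⇔ subtree (f x) (node a) ∈ ℒ) →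
    ∀ x → ¬ (∀ u → game em SameParity (f x) u ≡ x u)
  W∈D⇒no-fixedPoint A (W⊆Diff , Diff⊆W) f A⇔ x fixed = x∉W (∉W⇒∈W x∉W)
    where
    ∉W⇒∈W : x ∉ W₍₀,₂₎ → x ∈ W₍₀,₂₎
    ∉W⇒∈W x∉W with a , x∈a , none ← least em (λ a → x ∈ extend A a) {α} (⊥-elim ∘ <ₒ-irrefl) =
      W-resp fixed (FirstIn⇒W em SameParity (f x)
        (a , (to (A⇔ x a) x∈a , first-parity (<ₒ-connex a α)) , λ b b<a → none b b<a ∘ from (A⇔ x b)))
      where
      first-parity : a <ₒ α ⊎ a ≡ α ⊎ α <ₒ a → SameParity a
      first-parity (inj₁ a<α) opp = x∉W (Diff⊆W (a , a<α , opp , x∈a a<α ,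
        λ b b<a x∈b → none b b<a λ _ → x∈b))
      first-parity (inj₂ (inj₁ refl)) = same-parity
      first-parity (inj₂ (inj₂ α<a)) _ = none α α<a (⊥-elim ∘ <ₒ-irrefl)

    x∉W : x ∉ W₍₀,₂₎
    x∉W x∈W with θ , θ<α , opp , x∈θ , none ← W⊆Diff x∈W
      | a , (a∈ℒ , Pa) , none⁺ ← W⇒FirstIn em SameParity (f x) (W-resp (sym ∘ fixed) x∈W)
      with <ₒ-connex a θ
    ... | inj₁ a<θ         = none a a<θ (from (A⇔ x a) a∈ℒ (<ₒ-trans a<θ θ<α))
    ... | inj₂ (inj₁ refl) = Pa opp
    ... | inj₂ (inj₂ θ<a)  = none⁺ θ θ<a (to (A⇔ x θ) λ _ → x∈θ)

W∉D : ExcludedMiddle 0ℓ → ∀ k (α : Ordinal k) → W₍₀,₂₎ ∉ D α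
W∉D em k α (A , analytic , _ , W≐Diff) =
  let f , causal , A⇔ = analytic⇒subtree∈ℒ em node-ranked (extend em α A) (extend-analytic em α A analytic)
      x , fixed = causal⇒fixedPoint (game em (SameParity em α) ∘ f) (λ x y u x≈y →
        game-local em (SameParity em α) (f x) (f y) u λ v v≤u →
          causal x y v λ w w<v → x≈y w (<-≤-trans w<v (s≤s⁻¹ v≤u))) (λ _ → Eve , zero)
  in W∈D⇒no-fixedPoint em α A W≐Diff f A⇔ x fixed

theorem5p8 : ExcludedMiddle 0ℓ →
    (∀ (n : ℕ) → n ≥ 1 → Complete (ω^ n) (ℒₙ n) × (ℒₙ n ≤W W₍₀,₂₎)) ×
    (∀ (k : ℕ) (α : Ordinal k) → W₍₀,₂₎ ∉ D α)
theorem5p8 em = (λ { (suc n) _ → ℒₙ-complete em n , FirstIn≤W em Odd }) , W∉D em
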